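{- Let $G=(V,E)$ be an undirected graph with failure probabilities $\mathbf{p}=(p_e)_{e\in E}$, let $\overrightarrow{G}=(V,A)$ be the associated bi-directed graph with root $r$, and let $\Psi:\mathcal{P}(A)\to\mathcal{P}(E)$ be the exploration map defined in the context. If a random root-connected subgraph $S'$ is drawn from $\pi_{\overrightarrow{G}}$, then $\Psi(S')$ has distribution $\pi_G$.
   Context: $G$ is a finite connected undirected graph without loops or multiple edges, and $0<p_e<1$ for all $e\in E$. $\{u,v\}$ denotes an undirected edge, and $(u,v)$ denotes an arc from $u$ to $v$. The bi-directed graph is $\overrightarrow{G}=(V,A)$ with $A=\{(u,v),(v,u)\mid\{u,v\}\in E\}$ and failure probabilities $p_{(u,v)}=p_{(v,u)}=p_{\{u,v\}}$. $\mathcal{P}(X)$ is the power set of $X$. An arbitrary ordering of $V$ is fixed, and the root $r$ is the first vertex in it. A directed graph on $V$ is root-connected if every vertex has a directed path to $r$. Distributions: $\pi_G$ is the distribution resulting from including each edge $e\in E$ independently with probability $1-p_e$ and conditioning on the resulting graph on $V$ being connected; $\pi_{\overrightarrow{G}}$ is the distribution resulting from including each arc $e\in A$ independently with probability $1-p_e$ and conditioning on the resulting directed graph on $V$ being root-connected. The map $\Psi$: given $S'\subseteq A$, maintain a set $V_e$ of explored vertices and a set $V_a$ of active vertices, initially $V_e=\emptyset$, $V_a=\{r\}$, and $\Psi(S')=\emptyset$. While $V_a\ne\emptyset$: let $v$ be the first vertex of $V_a$ in the fixed ordering; for all $u\in V\setminus V_e$ with $(u,v)\in S'$, add $\{u,v\}$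 to $\Psi(S')$ and add $u$ to $V_a$ ($u$ may already be in $V_a$); then move $v$ from $V_a$ to $V_e$. The process ends when all vertices that can reach $r$ in $(V,S')$ are explored. -}

module Defs where

open import Algebra.Apartness.Bundles using (HeytingField; HeytingCommutativeRing)
open import Algebra.Bundles using (CommutativeRing; CommutativeMonoid)
import Algebra.Definitions.RawMonoid as RawMonoid
open import Data.Bool.Base using (if_then_else_)
import Data.Bool.Properties as Bool
open import Data.Fin.Base using (Fin; zero; suc; splitAt; join) renaming (_<_ to _<ᶠ_)
import Data.Fin.Properties as Fin
open import Data.Fin.Subset
  using (Subset; inside; outside; _∈_; _∉_; _∪_; _─_; ⁅_⁆; ⊤; ⊥; ∣_∣)
import Data.Fin.Subset.Properties as Subset
open import Data.List.Base using (List; []; _∷_; allFin)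
open import Data.List.Membership.Propositional using () renaming (_∈_ to _∈ˡ_)
open import Data.List.Membership.Propositional.Properties using (∈-allFin)
open import Data.List.Relation.Unary.Any using (here; there)
open import Data.Maybe.Base as Maybe using (Maybe; just; nothing; maybe′)
open import Data.Nat.Base as ℕ using (ℕ; zero; suc; _≤_)
import Data.Nat.Properties as ℕ
open import Data.Product.Base using (∃-syntax; _×_; _,_; proj₁; proj₂; swap)
import Data.Product.Properties as Product
open import Data.Sum.Base using (_⊎_; inj₁; inj₂; [_,_]′; reduce)
open import Data.Vec.Base using ([]; _∷_; here; there; lookup; tabulate)
import Data.Vec.Properties as Vec
open import Function.Base using (_∘_; id)
open import Function.Bundles using (_⇔_; Equivalence)
open import Function.Definitions using (Injective)
open import Level using (Level; _⊔_) renaming (suc to lsuc)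
open import Relation.Binary.Core using (Rel)
import Relation.Binary.Definitions as B
open import Relation.Binary.Construct.Closure.Reflexive using (ReflClosure; refl; [_])
import Relation.Binary.Construct.Closure.Reflexive.Properties as Refl
open import Relation.Binary.Construct.Closure.ReflexiveTransitive
  using (Star; ε; _◅_; _◅◅_; map)
open import Relation.Binary.PropositionalEquality
  using (_≡_; refl; sym; trans; cong; subst)
open import Relation.Binary.Structures using (IsStrictPartialOrder)
open import Relation.Nullary using (does; yes; no; contradiction)
open import Relation.Nullary.Decidable using (map′; _×-dec_; _⊎-dec_; ¬?)
open import Relation.Unary using (Pred; Decidable)

private
  variable
    ℓ c ℓ₁ ℓ₂ ℓ₃ : Level
    k n : ℕ

-- The order need not be total or decidable: classical ordered fields (ℚ, ℝ)
-- are instances, and so are the constructive reals.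

record OrderedField c ℓ₁ ℓ₂ ℓ₃ : Set (lsuc (c ⊔ ℓ₁ ⊔ ℓ₂ ⊔ ℓ₃)) where
  infix 4 _<_
  field
    heytingField : HeytingField c ℓ₁ ℓ₂
  open HeytingField heytingField public
  field
    _<_                  : Rel Carrier ℓ₃
    isStrictPartialOrder : IsStrictPartialOrder _≈_ _<_
    #⇔<⊎>                : ∀ x y → (x # y) ⇔ (x < y ⊎ y < x)
    +-monoˡ-<            : ∀ {x y} z → x < y → x + z < y + z
    *-pos                : ∀ {x y} → 0# < x → 0# < y → 0# < x * y
    0<1                  : 0# < 1#
  open IsStrictPartialOrder isStrictPartialOrder public
    using (<-respʳ-≈; <-respˡ-≈) renaming (trans to <-trans)

  open HeytingCommutativeRing heytingCommutativeRing public using (commutativeRing)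
  open CommutativeRing commutativeRing public using (*-commutativeMonoid)

  -- HeytingField phrases the invertibility of x as that of x - 0#.
  recip : ∀ {x} → 0# < x → Carrier
  recip {x} 0<x = proj₁ (#⇒invertible {x} {0#} (Equivalence.from (#⇔<⊎> x 0#) (inj₂ 0<x)))

comprehension : {P : Pred (Fin k) ℓ} → Decidable P → Subset k
comprehension P? = tabulate (does ∘ P?)

syntax comprehension (λ x → P) = ⟪ x ∣ P ⟫

first : Subset k → Maybe (Fin k)
first []            = nothing
first (inside  ∷ s) = just zero
first (outside ∷ s) = Maybe.map suc (first s)

first-∈ : (s : Subset k) {v : Fin k} → first s ≡ just v → v ∈ s
first-∈ (inside  ∷ s) refl = here
first-∈ (outside ∷ s) eq with first s in eq′
first-∈ (outside ∷ s) refl | just w = there (first-∈ s eq′)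

first-⊥ : (s : Subset k) → first s ≡ nothing → s ≡ ⊥
first-⊥ []            _  = refl
first-⊥ (outside ∷ s) eq with first s in eq′
first-⊥ (outside ∷ s) _  | nothing = cong (outside ∷_) (first-⊥ s eq′)

∈─⇒∉ : (s t : Subset k) {u : Fin k} → u ∈ s ─ t → u ∉ t
∈─⇒∉ (_ ∷ s) (inside  ∷ t) ()         here
∈─⇒∉ (_ ∷ s) (inside  ∷ t) (there u∈) (there u∈t) = ∈─⇒∉ s t u∈ u∈t
∈─⇒∉ (_ ∷ s) (outside ∷ t) (there u∈) (there u∈t) = ∈─⇒∉ s t u∈ u∈t

-- Reachability in a finite graph is decidable: Via xs relates the endpoints of
-- walks whose intermediate vertices all lie in xs (Floyd–Warshall).

module _ {R : Rel (Fin k) ℓ} where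

  Via : List (Fin k) → Rel (Fin k) ℓ
  Via []       u v = ReflClosure R u v
  Via (x ∷ xs) u v = Via xs u v ⊎ (Via xs u x × Via xs x v)

  via? : B.Decidable R → ∀ xs → B.Decidable (Via xs)
  via? R? []       u v = Refl.dec Fin._≟_ R? u v
  via? R? (x ∷ xs) u v = via? R? xs u v ⊎-dec (via? R? xs u x ×-dec via? R? xs x v)

  via⇒star : ∀ xs {u v} → Via xs u v → Star R u v
  via⇒star []       refl             = ε
  via⇒star []       [ r ]            = r ◅ ε
  via⇒star (x ∷ xs) (inj₁ p)         = via⇒star xs p
  via⇒star (x ∷ xs) (inj₂ (p , q))   = via⇒star xs p ◅◅ via⇒star xs q

  via-base : ∀ xs {u v} → ReflClosure R u v → Via xs u v
  via-base []       p = p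
  via-base (x ∷ xs) p = inj₁ (via-base xs p)

  via-trans : ∀ {xs u w v} → w ∈ˡ xs → Via xs u w → Via xs w v → Via xs u v
  via-trans {xs = x ∷ xs} (here refl) p q = inj₂ (to-x p , from-x q)
    where
    to-x : ∀ {u} → Via (x ∷ xs) u x → Via xs u x
    to-x = [ id , proj₁ ]′
    from-x : ∀ {v} → Via (x ∷ xs) x v → Via xs x v
    from-x = [ id , proj₂ ]′
  via-trans (there w∈) (inj₁ p)        (inj₁ q)        = inj₁ (via-trans w∈ p q)
  via-trans (there w∈) (inj₁ p)        (inj₂ (q , q′)) = inj₂ (via-trans w∈ p q , q′)
  via-trans (there w∈) (inj₂ (p , p′)) (inj₁ q)        = inj₂ (p , via-trans w∈ p′ q)
  via-trans (there w∈) (inj₂ (p , p′)) (inj₂ (q , q′)) = inj₂ (p , q′)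

  star⇒via : ∀ {u v} → Star R u v → Via (allFin k) u v
  star⇒via ε        = via-base (allFin k) refl
  star⇒via (r ◅ rs) = via-trans (∈-allFin _) (via-base (allFin k) [ r ]) (star⇒via rs)

  star? : B.Decidable R → B.Decidable (Star R)
  star? R? u v = map′ (via⇒star (allFin k)) star⇒via (via? R? (allFin k) u v)

-- The vertex set is identified with an initial segment of ℕ along its fixed
-- ordering.  The edge {u , v} is stored as (u , v) with u < v, which excludes
-- loops; injectivity excludes multiple edges.

record Graph : Set where
  field
    order-1   : ℕ
    size      : ℕ
  Vertex : Set
  Vertex = Fin (suc order-1)
  Edge : Set
  Edge = Fin size
  field
    ends           : Edge → Vertex × Vertex
    ends-<         : ∀ e → proj₁ (ends e) <ᶠ proj₂ (ends e)
    ends-injective : Injective _≡_ _≡_ ends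

module _ (G : Graph) where
  open Graph G

  EdgeSet VertexSet ArcSet : Set
  EdgeSet   = Subset size
  VertexSet = Subset (suc order-1)

  -- Each edge contributes two arcs: its stored orientation (first summand) and
  -- the reverse one (second summand).
  Arc : Set
  Arc = Fin (size ℕ.+ size)

  ArcSet = Subset (size ℕ.+ size)

  root : Vertex
  root = zero

  -- (u , v) = (tail , head)
  arc : Arc → Vertex × Vertex
  arc a = [ ends , swap ∘ ends ]′ (splitAt size a)

  underlying : Arc → Edge
  underlying a = reduce (splitAt size a)

  _≟ᵛᵛ_ : B.DecidableEquality (Vertex × Vertex)
  _≟ᵛᵛ_ = Product.≡-dec Fin._≟_ Fin._≟_

  -- e = {u , v}
  Joins : Edge → Rel Vertex _
  Joins e u v = ends e ≡ (u , v) ⊎ ends e ≡ (v , u)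

  joins? : ∀ e → B.Decidable (Joins e)
  joins? e u v = (ends e ≟ᵛᵛ (u , v)) ⊎-dec (ends e ≟ᵛᵛ (v , u))

  -- {u , v} ∈ S
  Adjacent : EdgeSet → Rel Vertex _
  Adjacent S u v = ∃[ e ] (e ∈ S × Joins e u v)

  adjacent? : ∀ S → B.Decidable (Adjacent S)
  adjacent? S u v = Fin.any? λ e → (e Subset.∈? S) ×-dec joins? e u v

  -- (u , v) ∈ S′
  HasArc : ArcSet → Rel Vertex _
  HasArc S′ u v = ∃[ a ] (a ∈ S′ × arc a ≡ (u , v))

  hasArc? : ∀ S′ → B.Decidable (HasArc S′)
  hasArc? S′ u v = Fin.any? λ a → (a Subset.∈? S′) ×-dec (arc a ≟ᵛᵛ (u , v))

  Connected : Pred EdgeSet _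
  Connected S = ∀ u v → Star (Adjacent S) u v

  connected? : Decidable Connected
  connected? S = Fin.all? λ u → Fin.all? λ v → star? (adjacent? S) u v

  RootConnected : Pred ArcSet _
  RootConnected S′ = ∀ v → Star (HasArc S′) v root

  rootConnected? : Decidable RootConnected
  rootConnected? S′ = Fin.all? λ v → star? (hasArc? S′) v root

  adjacent⇒hasArc : ∀ {u v} → Adjacent ⊤ u v → HasArc ⊤ u v
  adjacent⇒hasArc (e , _ , inj₁ eq) =
    join size size (inj₁ e) , Subset.∈⊤ ,
    trans (cong [ ends , swap ∘ ends ]′ (Fin.splitAt-join size size (inj₁ e))) eq
  adjacent⇒hasArc (e , _ , inj₂ eq) =
    join size size (inj₂ e) , Subset.∈⊤ ,
    trans (cong [ ends , swap ∘ ends ]′ (Fin.splitAt-join size size (inj₂ e))) (cong swap eq)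

  connected⇒rootConnected : Connected ⊤ → RootConnected ⊤
  connected⇒rootConnected conn v = map adjacent⇒hasArc (conn v root)

  record State : Set where
    constructor state
    field
      explored : VertexSet
      active   : VertexSet
      found    : EdgeSet
  open State

  initial : State
  initial = state ⊥ ⁅ root ⁆ ⊥

  Discovers : ArcSet → State → Vertex → Vertex → Set
  Discovers S′ σ v u = u ∉ explored σ × HasArc S′ u v

  discovers? : ∀ S′ σ v → Decidable (Discovers S′ σ v)
  discovers? S′ σ v u = ¬? (u Subset.∈? explored σ) ×-dec hasArc? S′ u v

  process : ArcSet → Vertex → State → State
  process S′ v σ = state
    (explored σ ∪ ⁅ v ⁆)
    ((active σ ∪ ⟪ u ∣ discovers? S′ σ v u ⟫) ─ ⁅ v ⁆)
    (found σ ∪ ⟪ e ∣ Fin.any? (λ u → discovers? S′ σ v u ×-dec joins? e u v) ⟫)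

  -- The while loop, bounded to a number of iterations.
  explore : ℕ → ArcSet → State → State
  explore zero    S′ σ = σ
  explore (suc i) S′ σ = maybe′ (λ v → explore i S′ (process S′ v σ)) σ (first (active σ))

  -- Every iteration explores a new vertex, so as many iterations as there are
  -- vertices run the loop to completion (final-active).
  final : ArcSet → State
  final S′ = explore (suc order-1) S′ initial

  Ψ : ArcSet → EdgeSet
  Ψ S′ = found (final S′)

  private
    Disjoint : State → Set
    Disjoint σ = ∀ {u} → u ∈ active σ → u ∉ explored σ

    ∈-comprehension⁻ : {P : Pred Vertex ℓ} (P? : Decidable P) {u : Vertex} →
                       u ∈ comprehension P? → P u
    ∈-comprehension⁻ P? {u} u∈
      with P? u | trans (sym (Vec.lookup∘tabulate (does ∘ P?) u)) (Vec.[]=⇒lookup u∈)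
    ... | yes p | _ = p

    process-disjoint : ∀ S′ v σ → Disjoint σ → Disjoint (process S′ v σ)
    process-disjoint S′ v σ dis u∈ u∈e
      with Subset.x∈p∪q⁻ (explored σ) ⁅ v ⁆ u∈e
    ... | inj₂ u∈v = ∈─⇒∉ _ ⁅ v ⁆ u∈ u∈v
    ... | inj₁ u∈σ with Subset.x∈p∪q⁻ (active σ) _ (Subset.p─q⊆p _ ⁅ v ⁆ u∈)
    ...   | inj₁ u∈a = dis u∈a u∈σ
    ...   | inj₂ u∈d = proj₁ (∈-comprehension⁻ (discovers? S′ σ v) u∈d) u∈σ

    explore-active : ∀ i S′ σ → Disjoint σ → suc order-1 ≤ i ℕ.+ ∣ explored σ ∣ →
                     active (explore i S′ σ) ≡ ⊥
    explore-active zero S′ σ dis full = Subset.Empty-unique λ (u , u∈) →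
      dis u∈ (subst (u ∈_) (sym explored≡⊤) Subset.∈⊤)
      where
      explored≡⊤ : explored σ ≡ ⊤
      explored≡⊤ = Subset.∣p∣≡n⇒p≡⊤ (ℕ.≤-antisym (Subset.∣p∣≤n (explored σ)) full)
    explore-active (suc i) S′ σ dis full with first (active σ) in eq
    ... | nothing = first-⊥ (active σ) eq
    ... | just v  = explore-active i S′ (process S′ v σ) (process-disjoint S′ v σ dis)
                      (ℕ.≤-trans full (ℕ.≤-trans (ℕ.≤-reflexive (sym (ℕ.+-suc i _)))
                        (ℕ.+-monoʳ-≤ i (Subset.p⊂q⇒∣p∣<∣q∣
                          ( Subset.p⊆p∪q ⁅ v ⁆
                          , v , Subset.q⊆p∪q (explored σ) ⁅ v ⁆ (Subset.x∈⁅x⁆ v)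
                          , dis (first-∈ (active σ) eq))))))

  final-active : ∀ S′ → active (final S′) ≡ ⊥
  final-active S′ = explore-active (suc order-1) S′ initial
    (λ _ → Subset.∉⊥) (ℕ.m≤m+n (suc order-1) _)

module _ (K : OrderedField c ℓ₁ ℓ₂ ℓ₃) where
  open OrderedField K hiding (zero) renaming (refl to ≈-refl; sym to ≈-sym; trans to ≈-trans)

  Mass : ℕ → Set c
  Mass k = Subset k → Carrier

  ∑ : Mass k → Carrier
  ∑ {zero}  μ = μ []
  ∑ {suc k} μ = ∑ (μ ∘ (inside ∷_)) + ∑ (μ ∘ (outside ∷_))

  ∏ : (Fin k → Carrier) → Carrier
  ∏ = RawMonoid.sum (CommutativeMonoid.rawMonoid *-commutativeMonoid)

  -- Each i is included independently with probability 1# - p i.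
  independent : (Fin k → Carrier) → Mass k
  independent p S = ∏ λ i → if lookup S i then 1# - p i else p i

  Pr : Mass k → {P : Pred (Subset k) ℓ} → Decidable P → Carrier
  Pr μ P? = ∑ λ S → if does (P? S) then μ S else 0#

  conditioned : (μ : Mass k) {P : Pred (Subset k) ℓ} (P? : Decidable P) →
                0# < Pr μ P? → Mass k
  conditioned μ P? 0<Pr S = if does (P? S) then μ S * recip 0<Pr else 0#

  pushforward : (Subset k → Subset n) → Mass k → Mass n
  pushforward f μ T = Pr μ λ S → Vec.≡-dec Bool._≟_ (f S) T

  ProperProbability : Pred Carrier _
  ProperProbability x = 0# < x × x < 1#

  private
    variable
      p : Fin k → Carrier

    1-x-pos : ∀ {x} → x < 1# → 0# < 1# - x
    1-x-pos {x} x<1 = <-respˡ-≈ (-‿inverseʳ x) (+-monoˡ-< (- x) x<1)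

    +-pos : ∀ {x y} → 0# < x → 0# < y → 0# < x + y
    +-pos {x} {y} 0<x 0<y =
      <-trans 0<y (<-respˡ-≈ (+-identityˡ y) (+-monoˡ-< y 0<x))

    NonNeg : Pred Carrier _
    NonNeg x = x ≈ 0# ⊎ 0# < x

    pos+nonNeg : ∀ {x y} → 0# < x → NonNeg y → 0# < x + y
    pos+nonNeg {x} 0<x (inj₁ y≈0) =
      <-respʳ-≈ (≈-sym (≈-trans (+-congˡ y≈0) (+-identityʳ x))) 0<x
    pos+nonNeg 0<x (inj₂ 0<y) = +-pos 0<x 0<y

    nonNeg+pos : ∀ {x y} → NonNeg x → 0# < y → 0# < x + y
    nonNeg+pos {x} {y} x≥0 0<y = <-respʳ-≈ (+-comm y x) (pos+nonNeg 0<y x≥0)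

    nonNeg+nonNeg : ∀ {x y} → NonNeg x → NonNeg y → NonNeg (x + y)
    nonNeg+nonNeg (inj₁ x≈0) (inj₁ y≈0) =
      inj₁ (≈-trans (+-cong x≈0 y≈0) (+-identityˡ 0#))
    nonNeg+nonNeg x≥0        (inj₂ 0<y) = inj₂ (nonNeg+pos x≥0 0<y)
    nonNeg+nonNeg (inj₂ 0<x) y≥0        = inj₂ (pos+nonNeg 0<x y≥0)

    ∑-nonNeg : {μ : Mass k} → (∀ S → NonNeg (μ S)) → NonNeg (∑ μ)
    ∑-nonNeg {zero}  μ≥0 = μ≥0 []
    ∑-nonNeg {suc k} μ≥0 = nonNeg+nonNeg (∑-nonNeg (μ≥0 ∘ (inside ∷_)))
                                         (∑-nonNeg (μ≥0 ∘ (outside ∷_)))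

    ∑-pos : {μ : Mass k} → (∀ S → NonNeg (μ S)) → ∀ S → 0# < μ S → 0# < ∑ μ
    ∑-pos μ≥0 []            0<μ = 0<μ
    ∑-pos μ≥0 (inside  ∷ S) 0<μ = pos+nonNeg (∑-pos (μ≥0 ∘ (inside ∷_)) S 0<μ)
                                             (∑-nonNeg (μ≥0 ∘ (outside ∷_)))
    ∑-pos μ≥0 (outside ∷ S) 0<μ = nonNeg+pos (∑-nonNeg (μ≥0 ∘ (inside ∷_)))
                                             (∑-pos (μ≥0 ∘ (outside ∷_)) S 0<μ)

    ∏-pos : {x : Fin k → Carrier} → (∀ i → 0# < x i) → 0# < ∏ x
    ∏-pos {zero}  0<x = 0<1
    ∏-pos {suc k} 0<x = *-pos (0<x zero) (∏-pos (0<x ∘ suc))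

    independent-pos : (∀ i → ProperProbability (p i)) →
                      ∀ (S : Subset k) → 0# < independent p S
    independent-pos {p = p} proper S = ∏-pos λ i → weight-pos i (lookup S i)
      where
      weight-pos : ∀ i b → 0# < (if b then 1# - p i else p i)
      weight-pos i inside  = 1-x-pos (proj₂ (proper i))
      weight-pos i outside = proj₁ (proper i)

  Pr-independent-pos : (∀ i → ProperProbability (p i)) →
                       {P : Pred (Subset k) ℓ} (P? : Decidable P) → ∀ {S} → P S →
                       0# < Pr (independent p) P?
  Pr-independent-pos {p = p} proper P? {S} PS = ∑-pos nonNeg S pos
    where
    nonNeg : ∀ S → NonNeg (if does (P? S) then independent p S else 0#)
    nonNeg S with P? S
    ... | yes _ = inj₂ (independent-pos proper S)
    ... | no  _ = inj₁ ≈-refl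
    pos : 0# < (if does (P? S) then independent p S else 0#)
    pos with P? S
    ... | yes _  = independent-pos proper S
    ... | no ¬PS = contradiction PS ¬PS

  module _ (G : Graph) (p : Graph.Edge G → Carrier)
           (proper : ∀ e → ProperProbability (p e)) (conn : Connected G ⊤) where

    π : Mass (Graph.size G)
    π = conditioned (independent p) (connected? G)
          (Pr-independent-pos proper (connected? G) conn)

    π⃗ : Mass (Graph.size G ℕ.+ Graph.size G)
    π⃗ = conditioned (independent (p ∘ underlying G)) (rootConnected? G)
          (Pr-independent-pos (proper ∘ underlying G) (rootConnected? G)
            (connected⇒rootConnected G conn))

{-# OPTIONS --safe #-}

-- For each edge, the exploration examines at most one of its two arcs: the one
-- whose head is the end explored first.  Hence any arc set that agrees with S′
-- on the examined arcs has the same run as S′.  If S′ is root-connected, every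
-- edge has an examined arc, and the edge is found iff that arc is in S′.  So, if
-- T is connected, the root-connected S′ with Ψ S′ = T are exactly those that
-- reproduce T on the arcs examined in the run on the bi-directed T, the other arc
-- of each edge being arbitrary; summing that arc out leaves the weight of T.  If
-- T is disconnected there is no such S′.  Summing over T, the normalising
-- constants agree as well.

module Submission where

open import Defs
open import Algebra.Bundles using (CommutativeRing)
import Algebra.Properties.CommutativeMonoid.Sum as CommutativeMonoidSum
import Algebra.Properties.CommutativeSemigroup as CommutativeSemigroupProperties
import Algebra.Properties.Ring as RingProperties
open import Data.Bool.Base using (Bool; true; false; if_then_else_)
import Data.Bool.Properties as Bool
open import Data.Fin.Base using (Fin; zero; suc; splitAt; _↑ˡ_; _↑ʳ_) renaming (_<_ to _<ᶠ_)
import Data.Fin.Properties as Fin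
open import Data.Fin.Subset
  using (Subset; inside; outside; _∈_; _∉_; _∪_; _─_; ⁅_⁆; ⊤)
import Data.Fin.Subset.Properties as Subset
open import Data.Maybe.Base using (just; nothing; maybe′)
open import Data.Nat.Base as ℕ using (ℕ; zero; suc)
open import Data.Product.Base using (∃-syntax; _×_; _,_; proj₁; proj₂; swap)
open import Data.Sum.Base as Sum using (_⊎_; inj₁; inj₂; [_,_]′; reduce)
open import Data.Vec.Base using (Vec; []; _∷_; lookup; tabulate; _++_)
import Data.Vec.Properties as Vec
open import Function.Base using (_∘_; id)
open import Function.Bundles using (_⇔_; mk⇔; Equivalence)
open import Function.Construct.Composition using (_⇔-∘_)
open import Relation.Binary.Construct.Closure.ReflexiveTransitive
  using (Star; ε; _◅_; _◅◅_; map; reverse)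
open import Relation.Binary.PropositionalEquality
  using (_≡_; _≢_; _≗_; refl; sym; trans; cong; cong₂; subst)
import Relation.Binary.Reasoning.Setoid as SetoidReasoning
open import Relation.Nullary using (¬_; Dec; does; yes; no; contradiction)
open import Relation.Nullary.Decidable using (_×-dec_; does-⇔; dec-true; dec-false)
open import Relation.Unary using (Pred; Decidable)

-- Membership, lookup and conditionals.

∈-comprehension⇔ : ∀ {k ℓ} {P : Pred (Fin k) ℓ} (P? : Decidable P) {x} →
                   x ∈ comprehension P? ⇔ P x
∈-comprehension⇔ {P = P} P? {x} = mk⇔ to from
  where
  to : x ∈ comprehension P? → P x
  to x∈ with P? x | trans (sym (Vec.lookup∘tabulate (does ∘ P?) x)) (Vec.[]=⇒lookup x∈)
  ... | yes Px | _ = Px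
  from : P x → x ∈ comprehension P?
  from Px = Vec.lookup⇒[]= x _
    (trans (Vec.lookup∘tabulate (does ∘ P?) x) (dec-true (P? x) Px))

comprehension-cong : ∀ {k ℓ ℓ′} {P : Pred (Fin k) ℓ} {Q : Pred (Fin k) ℓ′}
                     (P? : Decidable P) (Q? : Decidable Q) →
                     (∀ x → P x ⇔ Q x) → comprehension P? ≡ comprehension Q?
comprehension-cong P? Q? P⇔Q = Vec.tabulate-cong λ x → does-⇔ (P⇔Q x) (P? x) (Q? x)

∈-resp-lookup : ∀ {m n} {p : Subset m} {q : Subset n} {x y} →
                lookup p x ≡ lookup q y → x ∈ p → y ∈ q
∈-resp-lookup eq x∈p = Vec.lookup⇒[]= _ _ (trans (sym eq) (Vec.[]=⇒lookup x∈p))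

∈⇔∈⇒lookup-≡ : ∀ {m n} {p : Subset m} {q : Subset n} {x y} →
               (x ∈ p ⇔ y ∈ q) → lookup p x ≡ lookup q y
∈⇔∈⇒lookup-≡ x∈p⇔y∈q = Bool.⇔→≡ {z = inside} (mk⇔
  (Vec.[]=⇒lookup ∘ Equivalence.to x∈p⇔y∈q ∘ Vec.lookup⇒[]= _ _)
  (Vec.[]=⇒lookup ∘ Equivalence.from x∈p⇔y∈q ∘ Vec.lookup⇒[]= _ _))

lookup-injective : ∀ {a} {A : Set a} {n} {xs ys : Vec A n} →
                   lookup xs ≗ lookup ys → xs ≡ ys
lookup-injective {xs = xs} {ys} eq =
  trans (sym (Vec.tabulate∘lookup xs))
    (trans (Vec.tabulate-cong eq) (Vec.tabulate∘lookup ys))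

if-yes : ∀ {a p} {A : Set a} {P : Set p} {x y : A} (P? : Dec P) → P →
         (if does P? then x else y) ≡ x
if-yes P? p = cong (if_then _ else _) (dec-true P? p)

if-no : ∀ {a p} {A : Set a} {P : Set p} {x y : A} (P? : Dec P) → ¬ P →
        (if does P? then x else y) ≡ y
if-no P? ¬p = cong (if_then _ else _) (dec-false P? ¬p)

nested-if-no : ∀ {a p q} {A : Set a} {P : Set p} {Q : Set q} {x y : A}
               (P? : Dec P) (Q? : Dec Q) → ¬ (Q × P) →
               (if does P? then (if does Q? then x else y) else y) ≡ y
nested-if-no (yes p) (yes q) ¬qp = contradiction (q , p) ¬qp
nested-if-no (yes _) (no _)  ¬qp = refl
nested-if-no (no _)  Q?      ¬qp = refl

-- Edges and their two arcs.

module _ (G : Graph) where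
  open Graph G
  open State

  private
    variable
      S′ S″ : ArcSet G
      T : EdgeSet G
      σ : State G
      e : Edge
      u v : Vertex

  ends-asym : ∀ {e e′} → ends e ≡ (u , v) → ends e′ ≢ (v , u)
  ends-asym {e = e} {e′} eq eq′ = Fin.<-asym
    (subst (λ (x , y) → x <ᶠ y) eq (ends-< e))
    (subst (λ (x , y) → x <ᶠ y) eq′ (ends-< e′))

  -- Edges stored the same way are equal by `ends-injective`; opposite storage of the same pair
  -- contradicts the increasing order of stored ends.
  joins-injective : ∀ {e e′} → Joins G e u v → Joins G e′ u v → e ≡ e′
  joins-injective (inj₁ p) (inj₁ q) = ends-injective (trans p (sym q))
  joins-injective (inj₂ p) (inj₂ q) = ends-injective (trans p (sym q))
  joins-injective (inj₁ p) (inj₂ q) = contradiction q (ends-asym p)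
  joins-injective (inj₂ p) (inj₁ q) = contradiction p (ends-asym q)

  Incident : Edge → Vertex → Set
  Incident e v = ∃[ u ] Joins G e u v

  incident? : ∀ e → Decidable (Incident e)
  incident? e v = Fin.any? λ u → joins? G e u v

  -- The arc of e with head v; junk unless v is an end of e.
  arcInto : Edge → Vertex → Arc G
  arcInto e v = if does (v Fin.≟ proj₂ (ends e)) then e ↑ˡ size else size ↑ʳ e

  arcInto-↑ˡ : ends e ≡ (u , v) → arcInto e v ≡ e ↑ˡ size
  arcInto-↑ˡ {e} {u} {v} eq
    rewrite dec-true (v Fin.≟ proj₂ (ends e)) (sym (cong proj₂ eq)) = refl

  arcInto-↑ʳ : ends e ≡ (v , u) → arcInto e v ≡ size ↑ʳ e
  arcInto-↑ʳ {e} {v} {u} eq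
    rewrite dec-false (v Fin.≟ proj₂ (ends e)) (λ v≡ →
      -- If `v` were also the second end, `e` would be a loop.
      ends-asym {e = e} {e} eq (trans eq (cong₂ _,_
        (trans v≡ (cong proj₂ eq)) (sym (trans v≡ (cong proj₂ eq)))))) = refl

  underlying-arcInto : ∀ e v → underlying G (arcInto e v) ≡ e
  underlying-arcInto e v with does (v Fin.≟ proj₂ (ends e))
  ... | true  = cong reduce (Fin.splitAt-↑ˡ size e size)
  ... | false = cong reduce (Fin.splitAt-↑ʳ size size e)

  arc-arcInto : Joins G e u v → arc G (arcInto e v) ≡ (u , v)
  arc-arcInto {e} (inj₁ eq) = trans (cong (arc G) (arcInto-↑ˡ eq))
    (trans (cong [ ends , swap ∘ ends ]′ (Fin.splitAt-↑ˡ size e size)) eq)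
  arc-arcInto {e} (inj₂ eq) = trans (cong (arc G) (arcInto-↑ʳ eq))
    (trans (cong [ ends , swap ∘ ends ]′ (Fin.splitAt-↑ʳ size size e)) (cong swap eq))

  arc⇒joins : ∀ {a} → arc G a ≡ (u , v) → Joins G (underlying G a) u v
  arc⇒joins {a = a} eq with splitAt size a
  ... | inj₁ e = inj₁ eq
  ... | inj₂ e = inj₂ (cong swap eq)

  arc⇒≡arcInto : ∀ {a} → arc G a ≡ (u , v) → a ≡ arcInto (underlying G a) v
  arc⇒≡arcInto {a = a} eq with splitAt size a in split
  ... | inj₁ e = trans (sym (Fin.splitAt⁻¹-↑ˡ split)) (sym (arcInto-↑ˡ eq))
  ... | inj₂ e = trans (sym (Fin.splitAt⁻¹-↑ʳ {m = size} split)) (sym (arcInto-↑ʳ (cong swap eq)))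

  -- Without parallel edges, `arcInto e v` is the only arc from `u` to `v`, so the existential
  -- collapses to a single membership.
  hasArc⇔arcInto∈ : Joins G e u v → HasArc G S′ u v ⇔ arcInto e v ∈ S′
  hasArc⇔arcInto∈ {e} {u} {v} {S′} j = mk⇔ to (λ a∈ → arcInto e v , a∈ , arc-arcInto j)
    where
    to : HasArc G S′ u v → arcInto e v ∈ S′
    to (a , a∈ , eq) = subst (_∈ S′)
      (trans (arc⇒≡arcInto eq) (cong (λ e → arcInto e v) (joins-injective (arc⇒joins eq) j))) a∈

  -- Bi-directed edge sets.

  -- The canonical representative of the fibre of `Ψ` over a connected `T`, against which the other
  -- members are compared.
  bidirected : EdgeSet G → ArcSet G
  bidirected T = tabulate (lookup T ∘ underlying G)

  hasArc-bidirected⇔adjacent : HasArc G (bidirected T) u v ⇔ Adjacent G T u v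
  hasArc-bidirected⇔adjacent {T} {u} {v} = mk⇔
    (λ (a , a∈ , eq) → underlying G a
                     , ∈-resp-lookup (Vec.lookup∘tabulate _ a) a∈
                     , arc⇒joins eq)
    (λ (e , e∈ , j) → arcInto e v
                    , ∈-resp-lookup (sym (trans (Vec.lookup∘tabulate _ (arcInto e v))
                        (cong (lookup T) (underlying-arcInto e v)))) e∈
                    , arc-arcInto j)

  rootConnected-bidirected⇔connected : RootConnected G (bidirected T) ⇔ Connected G T
  rootConnected-bidirected⇔connected {T} = mk⇔ to from
    where
    adjacent-sym : ∀ {u v} → Adjacent G T u v → Adjacent G T v u
    adjacent-sym (e , e∈ , j) = e , e∈ , Sum.swap j
    to : RootConnected G (bidirected T) → Connected G T
    to rc u v = walk u ◅◅ reverse adjacent-sym (walk v)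
      where
      walk : ∀ u → Star (Adjacent G T) u (root G)
      walk u = map (Equivalence.to hasArc-bidirected⇔adjacent) (rc u)
    from : Connected G T → RootConnected G (bidirected T)
    from conn v = map (Equivalence.from hasArc-bidirected⇔adjacent) (conn v (root G))

  -- Loop invariants of the exploration.

  explore-induction : ∀ {ℓ} (P : State G → Set ℓ) →
    (∀ {σ v} → first (active σ) ≡ just v → P σ → P (process G S′ v σ)) →
    ∀ i σ → P σ → P (explore G i S′ σ)
  explore-induction P step zero    σ Pσ = Pσ
  explore-induction P step (suc i) σ Pσ with first (active σ) in eq
  ... | nothing = Pσ
  ... | just v  = explore-induction P step i _ (step eq Pσ)

  Seen : State G → Vertex → Set
  Seen σ u = u ∈ explored σ ⊎ u ∈ active σ

  -- The only vertex removed from `active` is `v`, and it enters `explored`; hence the case split on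
  -- `u ≡ v`.
  seen-process⁺ : ∀ S′ v σ → Seen σ u ⊎ Discovers G S′ σ v u → Seen (process G S′ v σ) u
  seen-process⁺ {u = u} S′ v σ new with u Fin.≟ v
  ... | yes refl = inj₁ (Subset.x∈p∪q⁺ (inj₂ (Subset.x∈⁅x⁆ v)))
  seen-process⁺ S′ v σ (inj₁ (inj₁ u∈)) | no _ = inj₁ (Subset.x∈p∪q⁺ (inj₁ u∈))
  seen-process⁺ S′ v σ (inj₁ (inj₂ u∈)) | no u≢v = inj₂
    (Subset.x∈p∧x∉q⇒x∈p─q (Subset.x∈p∪q⁺ (inj₁ u∈)) (Subset.x≢y⇒x∉⁅y⁆ u≢v))
  seen-process⁺ S′ v σ (inj₂ d) | no u≢v = inj₂ (Subset.x∈p∧x∉q⇒x∈p─q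
    (Subset.x∈p∪q⁺ (inj₂ (Equivalence.from (∈-comprehension⇔ (discovers? G S′ σ v)) d)))
    (Subset.x≢y⇒x∉⁅y⁆ u≢v))

  active-process⁻ : ∀ S′ v σ → u ∈ active (process G S′ v σ) →
                    u ∈ active σ ⊎ Discovers G S′ σ v u
  active-process⁻ S′ v σ u∈ = Sum.map₂
    (Equivalence.to (∈-comprehension⇔ (discovers? G S′ σ v)))
    (Subset.x∈p∪q⁻ (active σ) _ (Subset.p─q⊆p _ ⁅ v ⁆ u∈))

  explored-process⁻ : ∀ S′ v σ → u ∈ explored (process G S′ v σ) → u ∈ explored σ ⊎ u ≡ v
  explored-process⁻ S′ v σ u∈ =
    Sum.map₂ (Subset.x∈⁅y⁆⇒x≡y v) (Subset.x∈p∪q⁻ (explored σ) ⁅ v ⁆ u∈)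

  -- `reaching` bounds the seen vertices from above, `root-seen` and `closed` from below: once
  -- `active` is empty, the explored vertices are exactly those that reach the root. `disjoint`
  -- makes each processed vertex a new one.
  record Invariant (S′ : ArcSet G) (σ : State G) : Set where
    field
      disjoint  : u ∈ active σ → u ∉ explored σ
      reaching  : Seen σ u → Star (HasArc G S′) u (root G)
      root-seen : Seen σ (root G)
      closed    : HasArc G S′ u v → v ∈ explored σ → Seen σ u
  open Invariant

  initial-invariant : Invariant S′ (initial G)
  initial-invariant .disjoint _ = Subset.∉⊥
  initial-invariant .reaching (inj₁ u∈) = contradiction u∈ Subset.∉⊥
  initial-invariant .reaching (inj₂ u∈) with refl ← Subset.x∈⁅y⁆⇒x≡y (root G) u∈ = ε
  initial-invariant .root-seen = inj₂ (Subset.x∈⁅x⁆ (root G))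
  initial-invariant .closed _ v∈ = contradiction v∈ Subset.∉⊥

  process-invariant : first (active σ) ≡ just v → Invariant S′ σ →
                      Invariant S′ (process G S′ v σ)
  process-invariant {σ} {v} {S′} eq inv = λ where
      .disjoint u∈a u∈e → [ (λ u∈e → [ (λ u∈a → disjoint inv u∈a u∈e) , (λ d → proj₁ d u∈e) ]′
                                      (active-process⁻ S′ v σ u∈a))
                          , (λ { refl → ∈─⇒∉ _ ⁅ v ⁆ u∈a (Subset.x∈⁅x⁆ v) }) ]′
                          (explored-process⁻ S′ v σ u∈e)
      .reaching (inj₁ u∈) → [ reaching inv ∘ inj₁ , (λ { refl → reach-v }) ]′
                              (explored-process⁻ S′ v σ u∈)
      .reaching (inj₂ u∈) → [ reaching inv ∘ inj₂ , (λ (_ , a) → a ◅ reach-v) ]′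
                              (active-process⁻ S′ v σ u∈)
      .root-seen → seen-process⁺ S′ v σ (inj₁ (root-seen inv))
      .closed {u} a w∈ → [ (λ w∈ → seen-process⁺ S′ v σ (inj₁ (closed inv a w∈)))
                         , (λ { refl → seen-process⁺ S′ v σ (discovered a) }) ]′
                           (explored-process⁻ S′ v σ w∈)
    where
    reach-v : Star (HasArc G S′) v (root G)
    reach-v = reaching inv (inj₂ (first-∈ (active σ) eq))
    discovered : HasArc G S′ u v → Seen σ u ⊎ Discovers G S′ σ v u
    discovered {u} a with u Subset.∈? explored σ
    ... | yes u∈ = inj₁ (inj₁ u∈)
    ... | no u∉  = inj₂ (u∉ , a)

  final-invariant : ∀ S′ → Invariant S′ (final G S′)
  final-invariant S′ = explore-induction (Invariant S′) process-invariant
    (suc order-1) (initial G) initial-invariant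

  -- At the end seen means explored, so `closed` propagates exploration backwards along any walk to
  -- the root. Root-connectedness thereby becomes a property of the final state alone.
  rootConnected⇔explored : RootConnected G S′ ⇔ (∀ v → v ∈ explored (final G S′))
  rootConnected⇔explored {S′} = mk⇔
    (λ rc v → all (rc v))
    (λ all v → reaching (final-invariant S′) (inj₁ (all v)))
    where
    seen⇒explored : Seen (final G S′) u → u ∈ explored (final G S′)
    seen⇒explored (inj₁ u∈) = u∈
    seen⇒explored (inj₂ u∈) = contradiction (subst (_ ∈_) (final-active G S′) u∈) Subset.∉⊥
    all : Star (HasArc G S′) u (root G) → u ∈ explored (final G S′)
    all ε        = seen⇒explored (root-seen (final-invariant S′))
    all (a ◅ as) = seen⇒explored (closed (final-invariant S′) a (all as))

  -- Examined edges and revealed arcs.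

  -- The end of e explored first by the run from σ; junk if neither end gets explored.
  firstEnd : ℕ → ArcSet G → State G → Edge → Vertex
  firstEnd zero    S′ σ e = root G
  firstEnd (suc i) S′ σ e = maybe′
    (λ v → if does (incident? e v) then v else firstEnd i S′ (process G S′ v σ) e)
    (root G) (first (active σ))

  revealed : ℕ → ArcSet G → State G → Edge → Arc G
  revealed i S′ σ e = arcInto e (firstEnd i S′ σ e)

  -- Expressed through the ends because exploring an end is what examines `e`: the arc into the
  -- first explored end is tested, and the opposite arc never is, its tail being explored already.
  Unexamined : State G → Edge → Set
  Unexamined σ e = ∀ {v} → Incident e v → v ∉ explored σ

  unexamined : Joins G e u v → u ∉ explored σ → v ∉ explored σ → Unexamined σ e
  unexamined (inj₁ eq) u∉ v∉ (_ , inj₁ eq′) with refl ← trans (sym eq) eq′ = v∉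
  unexamined (inj₁ eq) u∉ v∉ (_ , inj₂ eq′) with refl ← trans (sym eq) eq′ = u∉
  unexamined (inj₂ eq) u∉ v∉ (_ , inj₁ eq′) with refl ← trans (sym eq) eq′ = u∉
  unexamined (inj₂ eq) u∉ v∉ (_ , inj₂ eq′) with refl ← trans (sym eq) eq′ = v∉

  unexamined-process : ∀ S′ σ → Unexamined σ e → ¬ Incident e v →
                       Unexamined (process G S′ v σ) e
  unexamined-process S′ σ un ¬inc inc u∈ with explored-process⁻ S′ _ σ u∈
  ... | inj₁ u∈σ  = un inc u∈σ
  ... | inj₂ refl = ¬inc inc

  unexamined-process⁻ : ∀ S′ v σ → Unexamined (process G S′ v σ) e →
                        Unexamined σ e × ¬ Incident e v
  unexamined-process⁻ S′ v σ un =
      (λ inc u∈ → un inc (Subset.x∈p∪q⁺ (inj₁ u∈)))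
    , (λ inc → un inc (Subset.x∈p∪q⁺ (inj₂ (Subset.x∈⁅x⁆ v))))

  -- Locality of the run.

  process-cong : (∀ u → Discovers G S′ σ v u ⇔ Discovers G S″ σ v u) →
                 process G S′ v σ ≡ process G S″ v σ
  process-cong {S′} {σ} {v} {S″} same = cong₂ (state _)
    (cong (λ D → (active σ ∪ D) ─ ⁅ v ⁆)
      (comprehension-cong (discovers? G S′ σ v) (discovers? G S″ σ v) same))
    (cong (found σ ∪_) (comprehension-cong
      (λ e → Fin.any? λ u → discovers? G S′ σ v u ×-dec joins? G e u v)
      (λ e → Fin.any? λ u → discovers? G S″ σ v u ×-dec joins? G e u v)
      λ e → mk⇔
        (λ (u , d , j) → u , Equivalence.to (same u) d , j)
        (λ (u , d , j) → u , Equivalence.from (same u) d , j)))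

  -- Only edges still to be examined count, and the arcs compared are those revealed by the run on
  -- `S′`; that the run on `S″` reveals the same ones is part of the conclusion of `explore-cong`.
  Agree : ℕ → ArcSet G → ArcSet G → State G → Set
  Agree i S′ S″ σ = ∀ {e} → Unexamined σ e →
    lookup S′ (revealed i S′ σ e) ≡ lookup S″ (revealed i S′ σ e)

  -- The next vertex `v` is unexplored, so every arc it tests belongs to an unexamined edge and is
  -- the revealed arc of that edge. Both sets therefore yield the same discoveries and the same next
  -- state, and induction applies.
  explore-cong : ∀ i σ → Invariant S′ σ → Agree i S′ S″ σ →
                 explore G i S′ σ ≡ explore G i S″ σ ×
                 (∀ {e} → Unexamined σ e → firstEnd i S′ σ e ≡ firstEnd i S″ σ e)
  -- With no iterations left, both first ends take the default value `root G`.
  explore-cong zero σ inv agree = refl , λ _ → refl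
  explore-cong {S′} {S″} (suc i) σ inv agree with first (active σ) in eq
  ... | nothing = refl , λ _ → refl
  ... | just v  =
      trans (proj₁ rec) (cong (explore G i S″) σ′≡σ″)
    , firstEnd-≡
    where
    σ′ = process G S′ v σ

    v∉ : v ∉ explored σ
    v∉ = disjoint inv (first-∈ (active σ) eq)

    agree-v : ∀ {u} → u ∉ explored σ → Joins G e u v →
              lookup S′ (arcInto e v) ≡ lookup S″ (arcInto e v)
    agree-v {e} {u} u∉ j =
      -- As `e` is incident to `v`, its first end in this run is `v` itself.
      subst (λ w → lookup S′ (arcInto e w) ≡ lookup S″ (arcInto e w))
        (if-yes (incident? e v) (u , j))
        (agree (unexamined {σ = σ} j u∉ v∉))

    same : ∀ u → Discovers G S′ σ v u ⇔ Discovers G S″ σ v u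
    same u = mk⇔
      (λ (u∉ , a) → let j = arc⇒joins (proj₂ (proj₂ a)) in u∉ ,
        Equivalence.from (hasArc⇔arcInto∈ j)
          (∈-resp-lookup (agree-v u∉ j) (Equivalence.to (hasArc⇔arcInto∈ j) a)))
      (λ (u∉ , a) → let j = arc⇒joins (proj₂ (proj₂ a)) in u∉ ,
        Equivalence.from (hasArc⇔arcInto∈ j)
          (∈-resp-lookup (sym (agree-v u∉ j)) (Equivalence.to (hasArc⇔arcInto∈ j) a)))

    σ′≡σ″ : σ′ ≡ process G S″ v σ
    σ′≡σ″ = process-cong same

    agree′ : Agree i S′ S″ σ′
    agree′ {e} un′ =
      subst (λ w → lookup S′ (arcInto e w) ≡ lookup S″ (arcInto e w))
        (if-no (incident? e v) ¬inc) (agree un)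
      where
      un   = proj₁ (unexamined-process⁻ S′ v σ un′)
      ¬inc = proj₂ (unexamined-process⁻ S′ v σ un′)

    rec = explore-cong i σ′ (process-invariant eq inv) agree′

    firstEnd-≡ : Unexamined σ e →
      (if does (incident? e v) then v else firstEnd i S′ σ′ e) ≡
      (if does (incident? e v) then v else firstEnd i S″ (process G S″ v σ) e)
    firstEnd-≡ {e} un = by-cases (incident? e v)
      where
      by-cases : Dec (Incident e v) → _
      by-cases (yes inc) =
        trans (if-yes (incident? e v) inc) (sym (if-yes (incident? e v) inc))
      by-cases (no ¬inc) =
        trans (if-no (incident? e v) ¬inc)
          (trans (proj₂ rec (unexamined-process S′ σ un ¬inc))
            (trans (cong (λ σ → firstEnd i S″ σ e) σ′≡σ″)
              (sym (if-no (incident? e v) ¬inc))))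

  -- When an edge is found.

  found-process⇔ : ∀ S′ v σ → e ∈ found (process G S′ v σ) ⇔
                   (e ∈ found σ ⊎ ∃[ u ] (Discovers G S′ σ v u × Joins G e u v))
  found-process⇔ {e} S′ v σ = mk⇔
    (Sum.map₂ (Equivalence.to (∈-comprehension⇔ P?)) ∘ Subset.x∈p∪q⁻ (found σ) _)
    (Subset.x∈p∪q⁺ ∘ Sum.map₂ (Equivalence.from (∈-comprehension⇔ P?)))
    where
    P? : Decidable λ e → ∃[ u ] (Discovers G S′ σ v u × Joins G e u v)
    P? e = Fin.any? λ u → discovers? G S′ σ v u ×-dec joins? G e u v


  found-process-unexamined : ∀ S′ v σ → Unexamined σ e → e ∉ found σ → ¬ Incident e v →
                             e ∉ found (process G S′ v σ)
  found-process-unexamined S′ v σ un e∉ ¬inc e∈ with Equivalence.to (found-process⇔ S′ v σ) e∈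
  ... | inj₁ e∈σ         = e∉ e∈σ
  ... | inj₂ (u , _ , j) = ¬inc (u , j)

  -- An edge added at this step joins `v` to an unexplored vertex, and `v` is unexplored too, so the
  -- edge cannot have the explored end `w`.
  found-process-examined : ∀ S′ v σ {w} → Invariant S′ σ → first (active σ) ≡ just v →
                           Incident e w → w ∈ explored σ →
                           e ∈ found (process G S′ v σ) ⇔ e ∈ found σ
  found-process-examined {e} S′ v σ {w} inv eq inc w∈ =
    mk⇔ ([ id , (λ (u , (u∉ , _) , j) → contradiction w∈ (unexamined {σ = σ} j u∉ v∉ inc)) ]′
          ∘ Equivalence.to (found-process⇔ S′ v σ))
        (Equivalence.from (found-process⇔ S′ v σ) ∘ inj₁)
    where
    v∉ : v ∉ explored σ
    v∉ = disjoint inv (first-∈ (active σ) eq)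

  found-explore-examined : ∀ i S′ σ {w} → Invariant S′ σ → Incident e w → w ∈ explored σ →
                           e ∈ found (explore G i S′ σ) ⇔ e ∈ found σ
  found-explore-examined zero S′ σ inv inc w∈ = mk⇔ id id
  found-explore-examined (suc i) S′ σ inv inc w∈ with first (active σ) in eq
  ... | nothing = mk⇔ id id
  ... | just v  =
    found-process-examined S′ v σ inv eq inc w∈ ⇔-∘
    found-explore-examined i S′ _ (process-invariant eq inv) inc (Subset.x∈p∪q⁺ (inj₁ w∈))

  -- The explored end `w` guarantees that the run examines `e`. When the first end `v` is processed,
  -- the other end is still unexplored, so `e` is found exactly when `arcInto e v` is present; later
  -- steps leave that verdict unchanged.
  found-explore⇔ : ∀ i S′ σ {w} → Invariant S′ σ → Unexamined σ e → e ∉ found σ →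
                   Incident e w → w ∈ explored (explore G i S′ σ) →
                   e ∈ found (explore G i S′ σ) ⇔ revealed i S′ σ e ∈ S′
  found-explore⇔ zero S′ σ inv un e∉ inc w∈ = contradiction w∈ (un inc)
  found-explore⇔ {e} (suc i) S′ σ inv un e∉ inc w∈ with first (active σ) in eq
  ... | nothing = contradiction w∈ (un inc)
  ... | just v  = by-cases (incident? e v)
    where
    inv′ = process-invariant eq inv
    by-cases : Dec (Incident e v) → _
    by-cases (yes (u , j)) =
      subst (λ w → e ∈ found (explore G i S′ (process G S′ v σ)) ⇔ arcInto e w ∈ S′)
        (sym (if-yes (incident? e v) (u , j)))
        (examine ⇔-∘ found-explore-examined i S′ _ inv′ (u , j)
          (Subset.x∈p∪q⁺ (inj₂ (Subset.x∈⁅x⁆ v))))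
      where
      examine : e ∈ found (process G S′ v σ) ⇔ arcInto e v ∈ S′
      examine = mk⇔
        ([ (λ e∈ → contradiction e∈ e∉)
         , (λ (_ , (_ , a) , j) → Equivalence.to (hasArc⇔arcInto∈ j) a) ]′
         ∘ Equivalence.to (found-process⇔ S′ v σ))
        (λ a∈ → Equivalence.from (found-process⇔ S′ v σ)
          (inj₂ (u , (un (v , Sum.swap j) , Equivalence.from (hasArc⇔arcInto∈ j) a∈) , j)))
    by-cases (no ¬inc) =
      subst (λ w → e ∈ found (explore G i S′ (process G S′ v σ)) ⇔ arcInto e w ∈ S′)
        (sym (if-no (incident? e v) ¬inc))
        (found-explore⇔ i S′ _ inv′ (unexamined-process S′ σ un ¬inc)
          (found-process-unexamined S′ v σ un e∉ ¬inc) inc w∈)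

  -- Decisive arcs and the fibres of `Ψ`.

  -- The arc of e that decides whether e enters Ψ S′: its head is the end explored first.
  decisive : ArcSet G → Edge → Arc G
  decisive S′ = revealed (suc order-1) S′ (initial G)

  unexamined-initial : Unexamined (initial G) e
  unexamined-initial _ = Subset.∉⊥

  ∈Ψ⇔decisive∈ : RootConnected G S′ → e ∈ Ψ G S′ ⇔ decisive S′ e ∈ S′
  ∈Ψ⇔decisive∈ {S′} {e} rc =
    found-explore⇔ (suc order-1) S′ (initial G) initial-invariant unexamined-initial
      -- Either end of `e` can serve as the explored end, since root-connectedness gets every vertex
      -- explored.
      Subset.∉⊥ (proj₂ (ends e) , inj₂ refl)
      (Equivalence.to rootConnected⇔explored rc _)

  Ψ-local : (∀ e → lookup S′ (decisive S′ e) ≡ lookup S″ (decisive S′ e)) →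
            final G S′ ≡ final G S″ × (∀ e → decisive S′ e ≡ decisive S″ e)
  Ψ-local {S′} {S″} agree
    with explore-cong {S″ = S″} (suc order-1) (initial G) initial-invariant (λ {e} _ → agree e)
  ... | final≡ , firstEnd≡ =
    final≡ , λ e → cong (arcInto e) (firstEnd≡ unexamined-initial)

  rootConnected-resp-final : final G S′ ≡ final G S″ → RootConnected G S′ → RootConnected G S″
  rootConnected-resp-final eq rc = Equivalence.from rootConnected⇔explored λ v →
    subst (λ σ → v ∈ explored σ) eq (Equivalence.to rootConnected⇔explored rc v)

  lookup-bidirected : ∀ T S′ e → lookup (bidirected T) (decisive S′ e) ≡ lookup T e
  lookup-bidirected T S′ e = trans (Vec.lookup∘tabulate _ (decisive S′ e))
    (cong (lookup T) (underlying-arcInto e (firstEnd (suc order-1) S′ (initial G) e)))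

  -- Either side makes `S′` and `bidirected T` agree on the decisive arcs of one of them, so
  -- `Ψ-local` identifies their final states and decisive arcs. The arcs on the right depend on `T`
  -- only, which leaves one independent constraint per edge.
  Ψ-fibre : ∀ S′ T → (RootConnected G S′ × Ψ G S′ ≡ T) ⇔
            (Connected G T × ∀ e → lookup S′ (decisive (bidirected T) e) ≡ lookup T e)
  Ψ-fibre S′ T = mk⇔ to from
    where
    B = bidirected T
    to : RootConnected G S′ × Ψ G S′ ≡ T →
         Connected G T × ∀ e → lookup S′ (decisive B e) ≡ lookup T e
    to (rc , refl) =
        Equivalence.to rootConnected-bidirected⇔connected
          (rootConnected-resp-final (proj₁ local) rc)
      , λ e → trans (cong (lookup S′) (sym (proj₂ local e))) (sym (read e))
      where
      read : ∀ e → lookup T e ≡ lookup S′ (decisive S′ e)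
      read e = ∈⇔∈⇒lookup-≡ (∈Ψ⇔decisive∈ rc)
      local = Ψ-local {S′} {B} λ e →
        trans (sym (read e)) (sym (lookup-bidirected T S′ e))
    from : Connected G T × (∀ e → lookup S′ (decisive B e) ≡ lookup T e) →
           RootConnected G S′ × Ψ G S′ ≡ T
    from (conn , agree) =
        rootConnected-resp-final (proj₁ local) rc
      , trans (cong found (sym (proj₁ local)))
          (lookup-injective λ e → trans (∈⇔∈⇒lookup-≡ (∈Ψ⇔decisive∈ rc))
            (lookup-bidirected T B e))
      where
      rc = Equivalence.from rootConnected-bidirected⇔connected conn
      local = Ψ-local {B} {S′} λ e →
        trans (lookup-bidirected T B e) (sym (agree e))

-- Sums over subsets and products over indices.

module _ {c ℓ₁ ℓ₂ ℓ₃} (K : OrderedField c ℓ₁ ℓ₂ ℓ₃) where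
  open OrderedField K using (commutativeRing; _<_; recip; #⇒invertible; #⇔<⊎>)
  open CommutativeRing commutativeRing 
    hiding (zero) renaming (refl to ≈-refl; sym to ≈-sym; trans to ≈-trans)
  open RingProperties ring using (-0#≈0#)
  open CommutativeSemigroupProperties +-commutativeSemigroup using (interchange)
  open SetoidReasoning setoid
  module *-Sum = CommutativeMonoidSum *-commutativeMonoid

  private
    variable
      k n : ℕ

  if-congˡ : ∀ b {x y z : Carrier} → x ≈ y → (if b then x else z) ≈ (if b then y else z)
  if-congˡ true  x≈y = x≈y
  if-congˡ false x≈y = ≈-refl

  ∑-cong : {μ ν : Mass K k} → (∀ S → μ S ≈ ν S) → ∑ K μ ≈ ∑ K ν
  ∑-cong {zero}  μ≈ν = μ≈ν []
  ∑-cong {suc k} μ≈ν = +-cong (∑-cong {k} (μ≈ν ∘ (inside ∷_))) (∑-cong {k} (μ≈ν ∘ (outside ∷_)))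

  ∑-zero : ∀ k → ∑ K {k} (λ _ → 0#) ≈ 0#
  ∑-zero zero    = ≈-refl
  ∑-zero (suc k) = ≈-trans (+-cong (∑-zero k) (∑-zero k)) (+-identityˡ 0#)

  ∑-distrib-+ : ∀ {k} (μ ν : Mass K k) → ∑ K (λ S → μ S + ν S) ≈ ∑ K μ + ∑ K ν
  ∑-distrib-+ {zero}  μ ν = ≈-refl
  ∑-distrib-+ {suc k} μ ν =
    ≈-trans (+-cong (∑-distrib-+ {k} _ _) (∑-distrib-+ {k} _ _)) (interchange _ _ _ _)

  *-distribʳ-∑ : (μ : Mass K k) (x : Carrier) → ∑ K μ * x ≈ ∑ K (λ S → μ S * x)
  *-distribʳ-∑ {zero}  μ x = ≈-refl
  *-distribʳ-∑ {suc k} μ x =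
    ≈-trans (distribʳ x _ _) (+-cong (*-distribʳ-∑ {k} _ x) (*-distribʳ-∑ {k} _ x))

  *-distribˡ-∑ : (x : Carrier) (μ : Mass K k) → x * ∑ K μ ≈ ∑ K (λ S → x * μ S)
  *-distribˡ-∑ {zero}  x μ = ≈-refl
  *-distribˡ-∑ {suc k} x μ =
    ≈-trans (distribˡ x _ _) (+-cong (*-distribˡ-∑ {k} x _) (*-distribˡ-∑ {k} x _))

  ∑-comm : (f : Subset k → Subset n → Carrier) →
           ∑ K (λ S → ∑ K (λ T → f S T)) ≈ ∑ K (λ T → ∑ K (λ S → f S T))
  ∑-comm {zero}  f = ≈-refl
  ∑-comm {suc k} {n} f = ≈-trans (+-cong (∑-comm (f ∘ (inside ∷_))) (∑-comm (f ∘ (outside ∷_))))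
                           (≈-sym (∑-distrib-+ {n} _ _))

  ∑-++ : ∀ m (μ : Mass K (m ℕ.+ n)) → ∑ K μ ≈ ∑ K {m} (λ A → ∑ K {n} (λ B → μ (A ++ B)))
  ∑-++ zero    μ = ≈-refl
  ∑-++ (suc m) μ = +-cong (∑-++ m _) (∑-++ m _)

  ∏-++ : ∀ m (f : Fin (m ℕ.+ n) → Carrier) →
         ∏ K f ≈ ∏ K (λ i → f (i ↑ˡ n)) * ∏ K (λ i → f (m ↑ʳ i))
  ∏-++ zero    f = ≈-sym (*-identityˡ _)
  ∏-++ (suc m) f = ≈-trans (*-congˡ (∏-++ m (f ∘ suc))) (≈-sym (*-assoc _ _ _))

  ∏-≈0 : {f : Fin k → Carrier} → ∀ i → f i ≈ 0# → ∏ K f ≈ 0#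
  ∏-≈0 zero    fi≈0 = ≈-trans (*-congʳ fi≈0) (zeroˡ _)
  ∏-≈0 (suc i) fi≈0 = ≈-trans (*-congˡ (∏-≈0 i fi≈0)) (zeroʳ _)

  ∑-point : (T : Subset k) (x : Carrier) →
            ∑ K (λ S → if does (Vec.≡-dec Bool._≟_ T S) then x else 0#) ≈ x
  ∑-point [] x = ≈-refl
  ∑-point {suc k} (inside  ∷ T) x =
    ≈-trans (+-cong (∑-point T x) (∑-zero k)) (+-identityʳ x)
  ∑-point {suc k} (outside ∷ T) x =
    ≈-trans (+-cong (∑-zero k) (∑-point T x)) (+-identityˡ x)

  -- After exchanging the sums, each `S` contributes at the single `T` equal to `f S`.
  ∑-pushforward : (f : Subset k → Subset n) (μ : Mass K k) → ∑ K (pushforward K f μ) ≈ ∑ K μ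
  ∑-pushforward {k} {n} f μ = begin
    ∑ K (pushforward K f μ)
      ≈⟨ ∑-comm {n} {k} _ ⟩
    ∑ K (λ S → ∑ K (λ T → if does (Vec.≡-dec Bool._≟_ (f S) T) then μ S else 0#))
      ≈⟨ ∑-cong {k} (λ S → ∑-point (f S) (μ S)) ⟩
    ∑ K μ ∎

  -- Generalised distributivity: expanding the product picks one pair of bits per index, that is, a
  -- pair of subsets.
  ∑∑-∏ : (g : Fin k → Bool → Bool → Carrier) →
         ∑ K {k} (λ A → ∑ K {k} (λ B → ∏ K (λ i → g i (lookup A i) (lookup B i)))) ≈
         ∏ K (λ i → (g i inside inside + g i inside outside) +
                    (g i outside inside + g i outside outside))
  ∑∑-∏ {zero}  g = ≈-refl
  ∑∑-∏ {suc k} g = begin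
    ∑ K (row inside) + ∑ K (row outside)
      ≈⟨ +-cong (∑-row inside) (∑-row outside) ⟩
    (g zero inside inside + g zero inside outside) * rest +
    (g zero outside inside + g zero outside outside) * rest
      ≈⟨ distribʳ _ _ _ ⟨
    ((g zero inside inside + g zero inside outside) +
     (g zero outside inside + g zero outside outside)) * rest
      ≈⟨ *-congˡ (∑∑-∏ (g ∘ suc)) ⟩
    _ ∎
    where
    tail : Subset k → Subset k → Carrier
    tail A B = ∏ K (λ i → g (suc i) (lookup A i) (lookup B i))
    rest = ∑ K (λ A → ∑ K (tail A))
    row : Bool → Subset k → Carrier
    -- The inner sum for a first subset with head `a` and tail `A`, split by the head of the second
    -- subset.
    row a A = ∑ K (λ B → g zero a inside * tail A B) + ∑ K (λ B → g zero a outside * tail A B)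
    ∑-row : ∀ a → ∑ K (row a) ≈ (g zero a inside + g zero a outside) * rest
    ∑-row a = begin
      ∑ K (row a)
        ≈⟨ ∑-cong {k} (λ A → +-cong (*-distribˡ-∑ {k} _ (tail A)) (*-distribˡ-∑ {k} _ (tail A))) ⟨
      ∑ K (λ A → g zero a inside * ∑ K (tail A) + g zero a outside * ∑ K (tail A))
        ≈⟨ ∑-cong {k} (λ A → distribʳ (∑ K (tail A)) _ _) ⟨
      ∑ K (λ A → (g zero a inside + g zero a outside) * ∑ K (tail A))
        ≈⟨ *-distribˡ-∑ {k} _ _ ⟨
      _ ∎

  -- Reciprocals and normalisation.

  recip-inverseˡ : ∀ {x} (0<x : 0# < x) → recip 0<x * x ≈ 1#
  recip-inverseˡ {x} 0<x =
    -- `#⇒invertible` inverts `x - 0#`, so `x` is rewritten to that first.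
    ≈-trans (*-congˡ (≈-sym (≈-trans (+-congˡ -0#≈0#) (+-identityʳ x))))
      (proj₁ (proj₂ (#⇒invertible (Equivalence.from (#⇔<⊎> x 0#) (inj₂ 0<x)))))

  -- `recip` is computed from a positivity proof; uniqueness of inverses makes its value independent
  -- of that proof.
  recip-cong : ∀ {x y} (0<x : 0# < x) (0<y : 0# < y) → x ≈ y → recip 0<x ≈ recip 0<y
  recip-cong {x} {y} 0<x 0<y x≈y = begin
    recip 0<x                   ≈⟨ *-identityʳ _ ⟨
    recip 0<x * 1#              ≈⟨ *-congˡ (≈-trans (*-comm _ _) (recip-inverseˡ 0<y)) ⟨
    recip 0<x * (y * recip 0<y) ≈⟨ *-assoc _ _ _ ⟨
    recip 0<x * y * recip 0<y   ≈⟨ *-congʳ (*-congˡ (≈-sym x≈y)) ⟩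
    recip 0<x * x * recip 0<y   ≈⟨ *-congʳ (recip-inverseˡ 0<x) ⟩
    1# * recip 0<y              ≈⟨ *-identityˡ _ ⟩
    recip 0<y                   ∎

  -- Conditioning before normalisation: `Pr` is its total and `conditioned` a rescaling of it.
  restrict : ∀ {ℓ} → Mass K k → {P : Pred (Subset k) ℓ} → Decidable P → Mass K k
  restrict μ P? S = if does (P? S) then μ S else 0#

  if-* : ∀ b {x} y → (if b then x else 0#) * y ≈ (if b then x * y else 0#)
  if-* true  y = ≈-refl
  if-* false y = zeroˡ y

  pushforward-cong : (f : Subset k → Subset n) {μ ν : Mass K k} → (∀ S → μ S ≈ ν S) →
                     ∀ T → pushforward K f μ T ≈ pushforward K f ν T
  pushforward-cong {k} f μ≈ν T =
    ∑-cong {k} λ S → if-congˡ (does (Vec.≡-dec Bool._≟_ (f S) T)) (μ≈ν S)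

  pushforward-* : (f : Subset k → Subset n) (μ : Mass K k) (x : Carrier) →
                  ∀ T → pushforward K f (λ S → μ S * x) T ≈ pushforward K f μ T * x
  pushforward-* {k} f μ x T = ≈-sym (≈-trans (*-distribʳ-∑ {k} _ x)
    (∑-cong {k} λ S → if-* (does (Vec.≡-dec Bool._≟_ (f S) T)) x))

  -- A pushforward preserves the total mass, so the normalising constants agree.
  pushforward-conditioned :
    ∀ {ℓ ℓ′} (f : Subset k → Subset n) {μ : Mass K k} {ν : Mass K n}
    {P : Pred (Subset k) ℓ} (P? : Decidable P) (0<Pr : 0# < Pr K μ P?)
    {Q : Pred (Subset n) ℓ′} (Q? : Decidable Q) (0<Pr′ : 0# < Pr K ν Q?) →
    (∀ T → pushforward K f (restrict μ P?) T ≈ restrict ν Q? T) →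
    ∀ T → pushforward K f (conditioned K μ P? 0<Pr) T ≈ conditioned K ν Q? 0<Pr′ T
  pushforward-conditioned {k} {n} f {μ} {ν} P? 0<Pr Q? 0<Pr′ push T = begin
    pushforward K f (conditioned K μ P? 0<Pr) T
      ≈⟨ pushforward-cong f (λ S → if-* (does (P? S)) (recip 0<Pr)) T ⟨
    pushforward K f (λ S → restrict μ P? S * recip 0<Pr) T
      ≈⟨ pushforward-* f (restrict μ P?) (recip 0<Pr) T ⟩
    pushforward K f (restrict μ P?) T * recip 0<Pr
      ≈⟨ *-cong (push T) (recip-cong 0<Pr 0<Pr′ Pr≈) ⟩
    restrict ν Q? T * recip 0<Pr′
      ≈⟨ if-* (does (Q? T)) (recip 0<Pr′) ⟩
    conditioned K ν Q? 0<Pr′ T ∎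
    where
    Pr≈ : Pr K μ P? ≈ Pr K ν Q?
    Pr≈ = ≈-trans (≈-sym (∑-pushforward f (restrict μ P?))) (∑-cong {n} push)

  -- Two independent bits per index.

  module _ (p : Fin k → Carrier) where

    weight : Fin k → Bool → Carrier
    weight i b = if b then 1# - p i else p i

    weight-total : ∀ i → weight i inside + weight i outside ≈ 1#
    weight-total i = ≈-trans (+-assoc 1# (- p i) (p i))
      (≈-trans (+-congˡ (-‿inverseˡ (p i))) (+-identityʳ 1#))

    module _ (left : Fin k → Bool) (T : Subset k) where

      -- The bits stand for the two arcs of one edge, and `left` says which of them is decisive.
      matched : Fin k → Bool → Bool → Carrier
      matched i a b =
        if does ((if left i then a else b) Bool.≟ lookup T i)
        then weight i a * weight i b else 0#

      -- Two of the four terms vanish; in the other two the unconstrained bit sums out to 1 by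
      -- `weight-total`.
      ∑-matched : ∀ i → (matched i inside inside + matched i inside outside) +
                        (matched i outside inside + matched i outside outside) ≈
                        weight i (lookup T i)
      ∑-matched i with left i | lookup T i
      ... | true  | true  = ≈-trans (+-congˡ (+-identityˡ 0#)) (≈-trans (+-identityʳ _)
        (≈-trans (≈-sym (distribˡ _ _ _)) (≈-trans (*-congˡ (weight-total i)) (*-identityʳ _))))
      ... | true  | false = ≈-trans (+-congʳ (+-identityˡ 0#)) (≈-trans (+-identityˡ _)
        (≈-trans (≈-sym (distribˡ _ _ _)) (≈-trans (*-congˡ (weight-total i)) (*-identityʳ _))))
      ... | false | true  = ≈-trans (+-cong (+-identityʳ _) (+-identityʳ _))
        (≈-trans (≈-sym (distribʳ _ _ _)) (≈-trans (*-congʳ (weight-total i)) (*-identityˡ _)))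
      ... | false | false = ≈-trans (+-cong (+-identityˡ _) (+-identityˡ _))
        (≈-trans (≈-sym (distribʳ _ _ _)) (≈-trans (*-congʳ (weight-total i)) (*-identityˡ _)))

  -- The unnormalised push-forward along `Ψ`.

  module _ (G : Graph) (p : Graph.Edge G → Carrier) where
    open Graph G

    p⃗ : Arc G → Carrier
    p⃗ = p ∘ underlying G

    -- `A` holds the stored orientations and `B` the reversed ones; both arcs of `e` carry the
    -- probability of `e`, so the factors regroup by edge.
    independent-++ : ∀ (A B : EdgeSet G) → independent K p⃗ (A ++ B) ≈
                     ∏ K (λ e → weight p e (lookup A e) * weight p e (lookup B e))
    independent-++ A B = begin
      independent K p⃗ (A ++ B)
        ≈⟨ ∏-++ size _ ⟩
      ∏ K (λ e → if lookup (A ++ B) (e ↑ˡ size) then 1# - p⃗ (e ↑ˡ size) else p⃗ (e ↑ˡ size)) *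
      ∏ K (λ e → if lookup (A ++ B) (size ↑ʳ e) then 1# - p⃗ (size ↑ʳ e) else p⃗ (size ↑ʳ e))
        ≡⟨ cong₂ _*_
            (*-Sum.sum-cong-≗ λ e → cong₂ (λ b e → weight p e b)
              (Vec.lookup-++ˡ A B e) (cong reduce (Fin.splitAt-↑ˡ size e size)))
            (*-Sum.sum-cong-≗ λ e → cong₂ (λ b e → weight p e b)
              (Vec.lookup-++ʳ A B e) (cong reduce (Fin.splitAt-↑ʳ size size e))) ⟩
      ∏ K (λ e → weight p e (lookup A e)) * ∏ K (λ e → weight p e (lookup B e))
        ≈⟨ *-Sum.∑-distrib-+ {size} _ _ ⟨
      _ ∎

    lookup-++-arcInto : ∀ (A B : EdgeSet G) e v → lookup (A ++ B) (arcInto G e v) ≡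
      (if does (v Fin.≟ proj₂ (ends e)) then lookup A e else lookup B e)
    lookup-++-arcInto A B e v with does (v Fin.≟ proj₂ (ends e))
    ... | true  = Vec.lookup-++ˡ A B e
    ... | false = Vec.lookup-++ʳ A B e

    -- By `Ψ-fibre` every term vanishes if `T` is disconnected; otherwise the fibre is cut out edge
    -- by edge, so the sum factors over the edges.
    pushforward-Ψ : ∀ T → pushforward K (Ψ G) (restrict (independent K p⃗) (rootConnected? G)) T ≈
                          restrict (independent K p) (connected? G) T
    pushforward-Ψ T = by-cases (connected? G T)
      where
      term : ArcSet G → Carrier
      term S′ = if does (Vec.≡-dec Bool._≟_ (Ψ G S′) T)
                then restrict (independent K p⃗) (rootConnected? G) S′ else 0#

      term-0 : ∀ S′ → ¬ (RootConnected G S′ × Ψ G S′ ≡ T) → term S′ ≡ 0#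
      term-0 S′ = nested-if-no (Vec.≡-dec Bool._≟_ (Ψ G S′) T) (rootConnected? G S′)

      head : Edge → Vertex
      head = firstEnd G (suc order-1) (bidirected G T) (initial G)

      -- The same test as in `arcInto`: true when the decisive arc has the stored orientation and so
      -- lies in the first half of `A ++ B`.
      left : Edge → Bool
      left e = does (head e Fin.≟ proj₂ (ends e))

      by-cases : Dec (Connected G T) →
                 ∑ K term ≈ restrict (independent K p) (connected? G) T
      by-cases (no ¬conn) = begin
        ∑ K term
          ≈⟨ ∑-cong (λ S′ → reflexive (term-0 S′
              (¬conn ∘ proj₁ ∘ Equivalence.to (Ψ-fibre G S′ T)))) ⟩
        ∑ K {size ℕ.+ size} (λ _ → 0#)
          ≈⟨ ∑-zero (size ℕ.+ size) ⟩
        0#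
          ≡⟨ if-no (connected? G T) ¬conn ⟨
        restrict (independent K p) (connected? G) T ∎
      by-cases (yes conn) = begin
        ∑ K term
          ≈⟨ ∑-++ size term ⟩
        ∑ K {size} (λ A → ∑ K {size} (λ B → term (A ++ B)))
          ≈⟨ ∑-cong {size} (λ A → ∑-cong {size} (λ B → term-++ A B)) ⟩
        ∑ K {size} (λ A → ∑ K {size} (λ B →
          ∏ K (λ e → matched p left T e (lookup A e) (lookup B e))))
          ≈⟨ ∑∑-∏ (matched p left T) ⟩
        _
          ≈⟨ *-Sum.sum-cong-≋ (∑-matched p left T) ⟩
        independent K p T
          ≡⟨ if-yes (connected? G T) conn ⟨
        restrict (independent K p) (connected? G) T ∎
        where
        module _ (A B : EdgeSet G) where
          chosen : Edge → Bool
          chosen e = if left e then lookup A e else lookup B e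

          matched-yes : (∀ e → chosen e ≡ lookup T e) → term (A ++ B) ≈
                        ∏ K (λ e → matched p left T e (lookup A e) (lookup B e))
          matched-yes same = begin
            term (A ++ B)
              ≡⟨ if-yes (Vec.≡-dec Bool._≟_ (Ψ G (A ++ B)) T) (proj₂ fibre) ⟩
            restrict (independent K p⃗) (rootConnected? G) (A ++ B)
              ≡⟨ if-yes (rootConnected? G (A ++ B)) (proj₁ fibre) ⟩
            independent K p⃗ (A ++ B)
              ≈⟨ independent-++ A B ⟩
            ∏ K (λ e → weight p e (lookup A e) * weight p e (lookup B e))
              ≡⟨ *-Sum.sum-cong-≗ (λ e → sym (if-yes (chosen e Bool.≟ lookup T e) (same e))) ⟩
            _ ∎
            where
            fibre = Equivalence.from (Ψ-fibre G (A ++ B) T)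
              (conn , λ e → trans (lookup-++-arcInto A B e (head e)) (same e))

          matched-no : ¬ (∀ e → chosen e ≡ lookup T e) → term (A ++ B) ≈
                       ∏ K (λ e → matched p left T e (lookup A e) (lookup B e))
          -- Decidability over finitely many edges gives an explicit violating edge, whose factor
          -- makes the product zero.
          matched-no ¬same with Fin.¬∀⟶∃¬ size _ (λ e → chosen e Bool.≟ lookup T e) ¬same
          ... | e , ¬same-e = ≈-trans
            (reflexive (term-0 (A ++ B) λ fibre → ¬same λ e →
              trans (sym (lookup-++-arcInto A B e (head e)))
                      (proj₂ (Equivalence.to (Ψ-fibre G (A ++ B) T) fibre) e)))
            (≈-sym (∏-≈0 e (reflexive (if-no (chosen e Bool.≟ lookup T e) ¬same-e))))

          term-++ : term (A ++ B) ≈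
                    ∏ K (λ e → matched p left T e (lookup A e) (lookup B e))
          term-++ with Fin.all? (λ e → chosen e Bool.≟ lookup T e)
          ... | yes same = matched-yes same
          ... | no ¬same = matched-no ¬same

lemma13 : ∀ {c ℓ₁ ℓ₂ ℓ₃} (K : OrderedField c ℓ₁ ℓ₂ ℓ₃)
    (G : Graph) (conn : Connected G ⊤)
    (p : Graph.Edge G → OrderedField.Carrier K)
    (proper : ∀ e → ProperProbability K (p e)) →
    ∀ T → OrderedField._≈_ K
    (pushforward K (Ψ G) (π⃗ K G p proper conn) T)
    (π K G p proper conn T)
lemma13 K G conn p proper = pushforward-conditioned K (Ψ G)
  (rootConnected? G) _ (connected? G) _ (pushforward-Ψ K G p)
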